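{- Let $q$ be a prime power, and let $C\subseteq\mathbb{F}_{q}((t))$ be any subfield. Let $\alpha$ be an existential $\mathcal{L}_{\mathrm{val}}$-formula with parameters from $C$. Then there exists an existential $\mathcal{L}_{\mathrm{ring}}$-formula $\beta$ with parameters in $C$ such that $\alpha$ and $\beta$ are equivalent modulo the theory of $\mathbb{F}_{q}((t))$.
   Context: $\mathcal{L}_{\mathrm{ring}}$ is the first-order language of rings, and $\mathcal{L}_{\mathrm{val}}:=\mathcal{L}_{\mathrm{ring}}\cup\{\mathcal{O}\}$ is the language of valued fields, where $\mathcal{O}$ is a unary predicate symbol. The field $\mathbb{F}_{q}((t))$ of formal Laurent series over the finite field $\mathbb{F}_{q}$ is regarded as an $\mathcal{L}_{\mathrm{val}}$-structure by interpreting $\mathcal{O}$ as the valuation ring $\mathbb{F}_{q}[[t]]$ of the $t$-adic valuation. Equivalence modulo the theory of $\mathbb{F}_{q}((t))$ refers to the complete theory of this structure with constants naming the elements of $C$; i.e. $\alpha$ and $\beta$ have the same free variables and define the same set in $\mathbb{F}_{q}((t))$. -}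

module Defs where

open import Algebra.Bundles using (CommutativeRing)
open import Algebra.Bundles.Raw using (RawRing)
open import Data.Empty using (⊥)
open import Data.Fin.Base using (Fin; toℕ)
open import Data.Integer.Base as ℤ using (ℤ; +_; -[1+_])
open import Data.Nat.Base as ℕ using (ℕ; zero; suc; _∸_; _^_)
open import Data.Nat.Primality using (Prime)
open import Data.Product.Base using (∃; ∃₂; _×_; proj₁)
open import Data.Sum.Base using (_⊎_)
open import Data.Vec.Base using (Vec; []; _∷_; lookup)
open import Function.Bundles using (Inverse)
open import Level using (Level; 0ℓ; _⊔_) renaming (suc to lsuc)
open import Relation.Binary.PropositionalEquality using (_≡_; setoid)
open import Relation.Nullary.Negation using (¬_)
open import Relation.Unary using (Pred)

------------------------------------------------------------------------
-- First-order logic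

record Language : Set₁ where
  field
    Fun : ℕ → Set
    Rel : ℕ → Set

open Language public

module _ {a : Level} (L : Language) (A : Set a) where

  -- Terms and formulas with parameters from A and free variables among
  -- n de Bruijn indices.  A quantifier binds index zero.

  data Term (n : ℕ) : Set a where
    var   : Fin n → Term n
    param : A → Term n
    fun   : ∀ {k} → Fun L k → Vec (Term n) k → Term n

  infix  8 _=′_
  infix  7 ¬′_
  infixr 6 _∧′_
  infixr 5 _∨′_
  infixr 4 _⇒′_

  data Formula (n : ℕ) : Set a where
    _=′_           : Term n → Term n → Formula n
    rel            : ∀ {k} → Rel L k → Vec (Term n) k → Formula n
    ¬′_            : Formula n → Formula n
    _∧′_ _∨′_ _⇒′_ : Formula n → Formula n → Formula n
    ∃′ ∀′          : Formula (suc n) → Formula n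

module _ {a : Level} {L : Language} {A : Set a} where

  data QuantifierFree {n : ℕ} : Formula L A n → Set a where
    _=′_ : ∀ s t → QuantifierFree (s =′ t)
    rel  : ∀ {k} (R : Rel L k) ts → QuantifierFree (rel R ts)
    ¬′_  : ∀ {φ} → QuantifierFree φ → QuantifierFree (¬′ φ)
    _∧′_ : ∀ {φ ψ} → QuantifierFree φ → QuantifierFree ψ → QuantifierFree (φ ∧′ ψ)
    _∨′_ : ∀ {φ ψ} → QuantifierFree φ → QuantifierFree ψ → QuantifierFree (φ ∨′ ψ)
    _⇒′_ : ∀ {φ ψ} → QuantifierFree φ → QuantifierFree ψ → QuantifierFree (φ ⇒′ ψ)

  -- ∃x₁ … ∃xₘ ψ with ψ quantifier-free, m ≥ 0.
  data Existential {n : ℕ} : Formula L A n → Set a where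
    matrix : ∀ {φ} → QuantifierFree φ → Existential φ
    ∃′     : ∀ {φ} → Existential {suc n} φ → Existential (∃′ φ)

-- As in the library's raw bundles, no laws are imposed: _≈_ interprets
-- the equality symbol, and need not come with proofs that it is a
-- congruence.
record RawStructure (L : Language) (ℓ : Level) : Set (lsuc ℓ) where
  field
    Carrier : Set ℓ
    _≈_     : Carrier → Carrier → Set ℓ
    ⟦_⟧ᶠ    : ∀ {k} → Fun L k → Vec Carrier k → Carrier
    ⟦_⟧ʳ    : ∀ {k} → Rel L k → Vec Carrier k → Set ℓ

module Semantics {a ℓ : Level} {L : Language} {A : Set a} (M : RawStructure L ℓ)
                 (name : A → RawStructure.Carrier M) where
  open RawStructure M

  mutual
    eval : ∀ {n} → Vec Carrier n → Term L A n → Carrier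
    eval ρ (var i)    = lookup ρ i
    eval ρ (param c)  = name c
    eval ρ (fun f ts) = ⟦ f ⟧ᶠ (evals ρ ts)

    evals : ∀ {n k} → Vec Carrier n → Vec (Term L A n) k → Vec Carrier k
    evals ρ []       = []
    evals ρ (t ∷ ts) = eval ρ t ∷ evals ρ ts

  infix 3 _⊨_

  _⊨_ : ∀ {n} → Vec Carrier n → Formula L A n → Set ℓ
  ρ ⊨ s =′ t    = eval ρ s ≈ eval ρ t
  ρ ⊨ rel R ts = ⟦ R ⟧ʳ (evals ρ ts)
  ρ ⊨ ¬′ φ     = ¬ (ρ ⊨ φ)
  ρ ⊨ φ ∧′ ψ   = (ρ ⊨ φ) × (ρ ⊨ ψ)
  ρ ⊨ φ ∨′ ψ   = (ρ ⊨ φ) ⊎ (ρ ⊨ ψ)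
  ρ ⊨ φ ⇒′ ψ   = (ρ ⊨ φ) → (ρ ⊨ ψ)
  ρ ⊨ ∃′ φ     = ∃ λ x → x ∷ ρ ⊨ φ
  ρ ⊨ ∀′ φ     = ∀ x → x ∷ ρ ⊨ φ

------------------------------------------------------------------------
-- The languages of rings and of valued fields

data RingFun : ℕ → Set where
  zero′ one′ : RingFun 0
  neg′       : RingFun 1
  add′ mul′  : RingFun 2

data ValRel : ℕ → Set where
  𝒪′ : ValRel 1

𝓛ring : Language
𝓛ring = record { Fun = RingFun ; Rel = λ _ → ⊥ }

𝓛val : Language
𝓛val = record { Fun = RingFun ; Rel = ValRel }

module _ {ℓ : Level} (R : RawRing ℓ ℓ) where
  open RawRing R

  ringFun : ∀ {k} → RingFun k → Vec Carrier k → Carrier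
  ringFun zero′ []           = 0#
  ringFun one′  []           = 1#
  ringFun neg′  (x ∷ [])     = - x
  ringFun add′  (x ∷ y ∷ []) = x + y
  ringFun mul′  (x ∷ y ∷ []) = x * y

  ringStructure : RawStructure 𝓛ring ℓ
  ringStructure = record
    { Carrier = Carrier ; _≈_ = _≈_ ; ⟦_⟧ᶠ = ringFun ; ⟦_⟧ʳ = λ () }

  valRel : Pred Carrier ℓ → ∀ {k} → ValRel k → Vec Carrier k → Set ℓ
  valRel 𝒪 𝒪′ (x ∷ []) = 𝒪 x

  valuedStructure : Pred Carrier ℓ → RawStructure 𝓛val ℓ
  valuedStructure 𝒪 = record
    { Carrier = Carrier ; _≈_ = _≈_ ; ⟦_⟧ᶠ = ringFun ; ⟦_⟧ʳ = valRel 𝒪 }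

------------------------------------------------------------------------
-- Fields

IsPrimePower : ℕ → Set
IsPrimePower q = ∃₂ λ p e → Prime p × q ≡ p ^ suc e

record IsFieldOfOrder {c ℓ : Level} (q : ℕ) (K : CommutativeRing c ℓ) : Set (c ⊔ ℓ) where
  open CommutativeRing K renaming (setoid to K-setoid)
  field
    1≉0     : 1# ≉ 0#
    inverse : ∀ x → x ≉ 0# → ∃ λ y → x * y ≈ 1#
    order   : Inverse K-setoid (setoid (Fin q))

-- Subfields, as subsets of a raw ring that is meant to be a field.
record IsSubfield {c ℓ p : Level} (R : RawRing c ℓ)
                  (C : Pred (RawRing.Carrier R) p) : Set (c ⊔ ℓ ⊔ p) where
  open RawRing R
  field
    resp       : ∀ {x y} → x ≈ y → C x → C y
    0-closed   : C 0#
    1-closed   : C 1#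
    +-closed   : ∀ {x y} → C x → C y → C (x + y)
    *-closed   : ∀ {x y} → C x → C y → C (x * y)
    neg-closed : ∀ {x} → C x → C (- x)
    inv-closed : ∀ {x y} → C x → x * y ≈ 1# → C y

------------------------------------------------------------------------
-- Formal Laurent series

module LaurentSeries {c ℓ : Level} (K : CommutativeRing c ℓ) where
  open CommutativeRing K
    using (Carrier; _≈_; _+_; _*_; -_; 0#; 1#; semiring)
  open import Algebra.Properties.Semiring.Sum semiring using (sum)

  PowerSeries : Set c
  PowerSeries = ℕ → Carrier

  -- Multiplication by tᵐ.
  shift : ℕ → PowerSeries → PowerSeries
  shift zero    a i       = a i
  shift (suc m) a zero    = 0#
  shift (suc m) a (suc i) = shift m a i

  _⊛_ : PowerSeries → PowerSeries → PowerSeries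
  (a ⊛ b) n = sum {suc n} λ i → a (toℕ i) * b (n ∸ toℕ i)

  -- laurent n a is Σ_{i ≥ 0} aᵢ tⁱ⁻ⁿ.  The leading aᵢ may vanish, so n is
  -- only a bound on the order of the pole and a series has many
  -- representations; they are identified by _≈ᴸ_ below.
  record Laurent : Set c where
    constructor laurent
    field
      pole   : ℕ
      series : PowerSeries

  open Laurent public

  extend : PowerSeries → ℤ → Carrier
  extend a (+ i)    = a i
  extend a -[1+ i ] = 0#

  -- The coefficient of tᵏ.
  coeff : Laurent → ℤ → Carrier
  coeff f k = extend (series f) (k ℤ.+ + pole f)

  _≈ᴸ_ : Laurent → Laurent → Set ℓ
  f ≈ᴸ g = ∀ k → coeff f k ≈ coeff g k

  constant : Carrier → PowerSeries
  constant x zero    = x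
  constant x (suc _) = 0#

  laurentRawRing : RawRing c ℓ
  laurentRawRing = record
    { Carrier = Laurent
    ; _≈_     = _≈ᴸ_
    ; _+_     = λ f g → laurent (pole f ℕ.+ pole g)
                  λ i → shift (pole g) (series f) i + shift (pole f) (series g) i
    ; _*_     = λ f g → laurent (pole f ℕ.+ pole g) (series f ⊛ series g)
    ; -_      = λ f → laurent (pole f) λ i → - series f i
    ; 0#      = laurent 0 (constant 0#)
    ; 1#      = laurent 0 (constant 1#)
    }

  -- K[[t]] inside K((t)).
  𝒪 : Pred Laurent ℓ
  𝒪 f = ∀ k → coeff f -[1+ k ] ≈ 0#

open LaurentSeries public using (Laurent; laurentRawRing)

module _ {ℓ c : Level} {n : ℕ} (K : CommutativeRing ℓ ℓ) (C : Pred (Laurent K) c) where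

  -- The subset of K((t))ⁿ defined by a formula with parameters from C.

  valDefinedSet : Formula 𝓛val (∃ C) n → Pred (Vec (Laurent K) n) ℓ
  valDefinedSet α ρ = ρ ⊨ α
    where open Semantics (valuedStructure (laurentRawRing K) (LaurentSeries.𝒪 K)) proj₁

  ringDefinedSet : Formula 𝓛ring (∃ C) n → Pred (Vec (Laurent K) n) ℓ
  ringDefinedSet β ρ = ρ ⊨ β
    where open Semantics (ringStructure (laurentRawRing K)) proj₁

{-# OPTIONS --safe #-}

-- Choose N ≥ 2 with aᴺ = a for every a ∈ 𝔽_q and put ℘(x) = xᴺ - x.  If x is
-- integral then ℘(x) ∈ m = t𝔽_q[[t]], and ℘ maps m onto m, by successive
-- approximation; if x is not integral then the pole of ℘(x) is that of xᴺ.
-- So ℘(x) - 1 lies in -1 + m or has a pole according to whether x is integral,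
-- and it never lies in m.  Hence x is integral iff
--   (℘(x) - 1)(℘(y) - 1) = 1
-- has a solution y, and x is not integral iff x ℘(y) = 1 for some integral y.
--
-- Membership of 𝒪 is decidable, so an atom 𝒪 t with any polarity can be
-- replaced by the above equation, provided that one first quantifies over y, z
-- witnessing one of the two alternatives.
module Submission where

open import Defs
open import Algebra.Bundles using (CommutativeRing)
open import Algebra.Bundles.Raw using (RawRing)
import Algebra.Definitions.RawSemiring as RawSemiringDefinitions
import Algebra.Properties.Ring as RingProperties
import Algebra.Properties.Semiring.Exp as Exp
open import Data.Fin.Base using (Fin; zero; suc; toℕ; _↑ˡ_; _↑ʳ_)
open import Data.Fin.Properties using (pigeonhole; toℕ<n) renaming (_≟_ to _≟ᶠ_)
open import Data.Integer.Base as ℤ using (ℤ; +_; -[1+_])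
import Data.Integer.Properties as ℤ
open import Data.Nat.Base as ℕ using (ℕ; zero; suc; z≤n; s≤s; _!)
open import Data.Nat.Divisibility using (_∣_; divides; ∣-trans; m∣m*n; m≤n⇒m!∣n!)
import Data.Nat.Properties as ℕ
open import Data.Product.Base using (∃; ∃₂; _×_; _,_; proj₁; proj₂)
open import Data.Product.Function.NonDependent.Propositional using (_×-⇔_)
open import Data.Sum.Base using (_⊎_; inj₁; inj₂)
open import Data.Sum.Function.Propositional using (_⊎-⇔_)
open import Data.Vec.Base using (Vec; []; _∷_; lookup; _++_)
open import Data.Vec.Properties using (lookup-++ˡ; lookup-++ʳ)
open import Function.Base using (_∘_; id)
open import Function.Bundles using (Inverse; Equivalence; _⇔_; mk⇔)
open import Level using (Level; _⊔_)
open import Relation.Binary.PropositionalEquality as ≡ using (_≡_; _≢_; refl)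
open import Relation.Nullary.Decidable.Core using (Dec; yes; no; map′)
open import Relation.Nullary.Negation using (¬_; contradiction)
open import Relation.Unary using (Pred; _≐_)

-- Power series

module Series {κ ℓ : Level} (K : CommutativeRing κ ℓ) where
  open CommutativeRing K hiding (refl; sym; trans)
  private module K = CommutativeRing K
  open RingProperties ring using (-0#≈0#; ⁻¹-anti-homo-//; //-rightDividesˡ)
  open LaurentSeries K public hiding (Laurent; laurentRawRing)
    renaming (_≈ᴸ_ to infix 4 _≈ᴸ_; _⊛_ to infixl 7 _⊛_)
  open import Relation.Binary.Reasoning.Setoid setoid

  infix 4 _≈ˢ_

  _≈ˢ_ : PowerSeries → PowerSeries → Set ℓ
  a ≈ˢ b = ∀ i → a i ≈ b i

  tail : PowerSeries → PowerSeries
  tail a i = a (suc i)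

  shift-cong : ∀ m {a b} → a ≈ˢ b → shift m a ≈ˢ shift m b
  shift-cong zero    a≈b i       = a≈b i
  shift-cong (suc m) a≈b zero    = K.refl
  shift-cong (suc m) a≈b (suc i) = shift-cong m a≈b i

  shift-+ : ∀ m n a → shift (m ℕ.+ n) a ≈ˢ shift m (shift n a)
  shift-+ zero    n a i       = K.refl
  shift-+ (suc m) n a zero    = K.refl
  shift-+ (suc m) n a (suc i) = shift-+ m n a i

  -- Agreement modulo tⁿ.
  Agree : ℕ → PowerSeries → PowerSeries → Set ℓ
  Agree n a b = ∀ i → i ℕ.< n → a i ≈ b i

  shift-agree : ∀ {n a b} → Agree n a b → Agree (suc n) (shift 1 a) (shift 1 b)
  shift-agree a≈b zero    _         = K.refl
  shift-agree a≈b (suc i) (s≤s i<n) = a≈b i i<n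

  -- Isolates the contribution of `a 0`. The remainder carries a factor t, which makes the operator
  -- in `divide` contractive.
  ⊛-unfold : ∀ a b i → (a ⊛ b) i ≈ a 0 * b i + shift 1 (tail a ⊛ b) i
  ⊛-unfold a b zero    = K.refl
  ⊛-unfold a b (suc i) = K.refl

  ⊛-head : ∀ a b → (a ⊛ b) 0 ≈ a 0 * b 0
  ⊛-head a b = +-identityʳ _

  -- A coefficient of a product involves only coefficients of the factors up to the same index. In
  -- the recursion the tail of `a` agrees to one order less, and the agreement of `b` is weakened to
  -- match.
  ⊛-agree : ∀ {n a a′ b b′} → Agree n a a′ → Agree n b b′ →
            Agree n (a ⊛ b) (a′ ⊛ b′)
  ⊛-agree a≈a′ b≈b′ zero 0<n =
    +-congʳ (*-cong (a≈a′ 0 0<n) (b≈b′ 0 0<n))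
  ⊛-agree a≈a′ b≈b′ (suc i) (s≤s i<n) =
    +-cong (*-cong (a≈a′ 0 (s≤s z≤n)) (b≈b′ (suc i) (s≤s i<n)))
           (⊛-agree (λ j j<n → a≈a′ (suc j) (s≤s j<n))
                    (λ j j<n → b≈b′ j (ℕ.m<n⇒m<1+n j<n)) i i<n)

  ⊛-cong : ∀ {a a′ b b′} → a ≈ˢ a′ → b ≈ˢ b′ → a ⊛ b ≈ˢ a′ ⊛ b′
  ⊛-cong a≈a′ b≈b′ i = ⊛-agree (λ j _ → a≈a′ j) (λ j _ → b≈b′ j) i (ℕ.n<1+n i)

  shift-⊛ˡ : ∀ m a b → shift m a ⊛ b ≈ˢ shift m (a ⊛ b)
  shift-⊛ˡ zero    a b i = K.refl
  shift-⊛ˡ (suc m) a b zero = begin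
    (shift (suc m) a ⊛ b) 0 ≈⟨ ⊛-head (shift (suc m) a) b ⟩
    0# * b 0                ≈⟨ zeroˡ _ ⟩
    0#                      ∎
  shift-⊛ˡ (suc m) a b (suc i) = begin
    0# * b (suc i) + (shift m a ⊛ b) i ≈⟨ +-congʳ (zeroˡ _) ⟩
    0# + (shift m a ⊛ b) i             ≈⟨ +-identityˡ _ ⟩
    (shift m a ⊛ b) i                  ≈⟨ shift-⊛ˡ m a b i ⟩
    shift m (a ⊛ b) i                  ∎

  -- The convolution unfolds along its left factor, so a shift of the right factor is pulled out by
  -- recursion on both the shift and the index.
  shift-⊛ʳ : ∀ m a b → a ⊛ shift m b ≈ˢ shift m (a ⊛ b)
  shift-⊛ʳ zero    a b i = K.refl
  shift-⊛ʳ (suc m) a b zero = begin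
    (a ⊛ shift (suc m) b) 0 ≈⟨ ⊛-head a (shift (suc m) b) ⟩
    a 0 * 0#                ≈⟨ zeroʳ _ ⟩
    0#                      ∎
  shift-⊛ʳ (suc m) a b (suc i) = begin
    a 0 * shift m b i + (tail a ⊛ shift (suc m) b) i       ≈⟨ +-congˡ (shift-⊛ʳ (suc m) (tail a) b i) ⟩
    a 0 * shift m b i + shift (suc m) (tail a ⊛ b) i       ≈⟨ +-congˡ (shift-+ 1 m (tail a ⊛ b) i) ⟩
    a 0 * shift m b i + shift 1 (shift m (tail a ⊛ b)) i   ≈⟨ +-congˡ (shift-cong 1 (shift-⊛ʳ m (tail a) b) i) ⟨
    a 0 * shift m b i + shift 1 (tail a ⊛ shift m b) i     ≈⟨ ⊛-unfold a (shift m b) i ⟨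
    (a ⊛ shift m b) i                                      ≈⟨ shift-⊛ʳ m a b i ⟩
    shift m (a ⊛ b) i                                      ∎

  infixr 8 _^ˢ_

  _^ˢ_ : PowerSeries → ℕ → PowerSeries
  a ^ˢ zero  = constant 1#
  a ^ˢ suc n = a ⊛ a ^ˢ n

  ^ˢ-agree : ∀ m {n a b} → Agree n a b → Agree n (a ^ˢ m) (b ^ˢ m)
  ^ˢ-agree zero    a≈b = λ _ _ → K.refl
  ^ˢ-agree (suc m) a≈b = ⊛-agree a≈b (^ˢ-agree m a≈b)

  -- Banach's theorem for the t-adic metric: the nth iterate from 0 agrees with all later ones
  -- modulo tⁿ, so the iterates converge coefficientwise.
  contraction-fixedPoint : (Φ : PowerSeries → PowerSeries) → (∀ n a b → Agree n a b → Agree (suc n) (Φ a) (Φ b)) →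
                           ∃ λ a → Φ a ≈ˢ a
  contraction-fixedPoint Φ contractive =
    -- `diagonal` agrees with `iterate n` modulo tⁿ, so its image agrees with `iterate (suc n)`
    -- modulo tⁿ⁺¹; at index `n` the latter is `diagonal n` by definition.
    diagonal , λ n → contractive n _ _ (λ i i<n → iterate-agree i<n i ℕ.≤-refl) n ℕ.≤-refl
    where
    iterate : ℕ → PowerSeries
    iterate zero    _ = 0#
    iterate (suc n)   = Φ (iterate n)
    iterate-agree : ∀ {m n} → m ℕ.≤ n → Agree m (iterate m) (iterate n)
    iterate-agree z≤n       = λ _ ()
    iterate-agree (s≤s m≤n) = contractive _ _ _ (iterate-agree m≤n)
    diagonal : PowerSeries
    diagonal n = iterate (suc n) n

  -- With u inverse to the constant term, b e = m rearranges to e = u (m - t (tail b) e), whose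
  -- right side is contractive in e.
  divide : ∀ (b : PowerSeries) {u} → b 0 * u ≈ 1# → ∀ m → ∃ λ e → b ⊛ e ≈ˢ m
  divide b {u} b₀u≈1 m = quotient (contraction-fixedPoint Φ Φ-contractive)
    where
    r : PowerSeries → PowerSeries
    r e = shift 1 (tail b ⊛ e)
    Φ : PowerSeries → PowerSeries
    Φ e i = u * (m i - r e i)
    Φ-contractive : ∀ n e f → Agree n e f → Agree (suc n) (Φ e) (Φ f)
    Φ-contractive n e f e≈f i i<n = *-congˡ (+-congˡ (-‿cong
      (shift-agree (⊛-agree {a = tail b} (λ _ _ → K.refl) e≈f) i i<n)))
    quotient : (∃ λ e → Φ e ≈ˢ e) → ∃ λ e → b ⊛ e ≈ˢ m
    quotient (e , Φe≈e) = e , λ i → begin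
      (b ⊛ e) i                          ≈⟨ ⊛-unfold b e i ⟩
      b 0 * e i + r e i                  ≈⟨ +-congʳ (*-congˡ (Φe≈e i)) ⟨
      b 0 * (u * (m i - r e i)) + r e i  ≈⟨ +-congʳ (*-assoc _ _ _) ⟨
      b 0 * u * (m i - r e i) + r e i    ≈⟨ +-congʳ (*-congʳ b₀u≈1) ⟩
      1# * (m i - r e i) + r e i         ≈⟨ +-congʳ (*-identityˡ _) ⟩
      m i - r e i + r e i                ≈⟨ //-rightDividesˡ (r e i) (m i) ⟩
      m i                                ∎

  -- The solution is sought in the form y = t z, for then yᴺ = t² z² yᴹ and
  -- z ↦ (yᴺ - e)/t is contractive.
  solve : ∀ M (e : PowerSeries) → e 0 ≈ 0# → ∃ λ y → ∀ i → (y ^ˢ suc (suc M)) i - y i ≈ e i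
  solve M e e₀≈0 = solution (contraction-fixedPoint Φ Φ-contractive)
    where
    s : PowerSeries → PowerSeries
    s z = z ⊛ (z ⊛ shift 1 z ^ˢ M)
    s-agree : ∀ n a b → Agree n a b → Agree n (s a) (s b)
    s-agree n a b a≈b = ⊛-agree {a = a} {b} a≈b (⊛-agree {a = a} {b} a≈b
      (^ˢ-agree M {a = shift 1 a} {shift 1 b} λ i i<n →
        shift-agree {a = a} {b} a≈b i (ℕ.m<n⇒m<1+n i<n)))
    Φ : PowerSeries → PowerSeries
    Φ z i = shift 1 (s z) i - e (suc i)
    Φ-contractive : ∀ n a b → Agree n a b → Agree (suc n) (Φ a) (Φ b)
    Φ-contractive n a b a≈b i i<n =
      +-congʳ (shift-agree {a = s a} {s b} (s-agree n a b a≈b) i i<n)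
    power : ∀ z → shift 1 z ^ˢ suc (suc M) ≈ˢ shift 1 (shift 1 (s z))
    power z i = begin
      (y ⊛ (y ⊛ y ^ˢ M)) i                  ≈⟨ shift-⊛ˡ 1 z (y ⊛ y ^ˢ M) i ⟩
      shift 1 (z ⊛ (y ⊛ y ^ˢ M)) i
        ≈⟨ shift-cong 1 {b = z ⊛ shift 1 (z ⊛ y ^ˢ M)}
             (⊛-cong {a = z} (λ _ → K.refl) (shift-⊛ˡ 1 z (y ^ˢ M))) i ⟩
      shift 1 (z ⊛ shift 1 (z ⊛ y ^ˢ M)) i
        ≈⟨ shift-cong 1 {b = shift 1 (s z)} (shift-⊛ʳ 1 z (z ⊛ y ^ˢ M)) i ⟩
      shift 1 (shift 1 (s z)) i             ∎
      where y = shift 1 z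
    solution : (∃ λ z → Φ z ≈ˢ z) → ∃ λ y → ∀ i → (y ^ˢ suc (suc M)) i - y i ≈ e i
    solution (z , Φz≈z) = shift 1 z , λ
      -- The fixed-point equation, being divided by t, says nothing about the constant term. There y
      -- and yᴺ both vanish, hence the hypothesis on `e 0`.
      { zero → begin
          (shift 1 z ^ˢ suc (suc M)) 0 - 0#   ≈⟨ +-cong (power z 0) -0#≈0# ⟩
          0# + 0#                             ≈⟨ +-identityˡ _ ⟩
          0#                                  ≈⟨ e₀≈0 ⟨
          e 0                                 ∎
      ; (suc i) → begin
          (shift 1 z ^ˢ suc (suc M)) (suc i) - z i
            ≈⟨ +-cong (power z (suc i)) (-‿cong (K.sym (Φz≈z i))) ⟩
          shift 1 (s z) i - (shift 1 (s z) i - e (suc i))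
            ≈⟨ +-congˡ (⁻¹-anti-homo-// (shift 1 (s z) i) (e (suc i))) ⟩
          shift 1 (s z) i + (e (suc i) - shift 1 (s z) i)
            ≈⟨ +-comm _ _ ⟩
          e (suc i) - shift 1 (s z) i + shift 1 (s z) i
            ≈⟨ //-rightDividesˡ (shift 1 (s z) i) (e (suc i)) ⟩
          e (suc i) ∎
      }

  -- Laurent series

  private module L = RawRing (laurentRawRing K)

  ≈ᴸ-refl : ∀ {f} → f ≈ᴸ f
  ≈ᴸ-refl _ = K.refl

  ≈ᴸ-trans : ∀ {f g h} → f ≈ᴸ g → g ≈ᴸ h → f ≈ᴸ h
  ≈ᴸ-trans f≈g g≈h k = K.trans (f≈g k) (g≈h k)

  extend-cong : ∀ {a b} → a ≈ˢ b → ∀ k → extend a k ≈ extend b k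
  extend-cong a≈b (+ i)    = a≈b i
  extend-cong a≈b -[1+ i ] = K.refl

  extend-+ : ∀ a b k → extend (λ i → a i + b i) k ≈ extend a k + extend b k
  extend-+ a b (+ i)    = K.refl
  extend-+ a b -[1+ i ] = K.sym (+-identityˡ 0#)

  extend-neg : ∀ a k → extend (λ i → - a i) k ≈ - extend a k
  extend-neg a (+ i)    = K.refl
  extend-neg a -[1+ i ] = K.sym -0#≈0#

  extend-shift : ∀ m a k → extend (shift m a) (k ℤ.+ + m) ≈ extend a k
  extend-shift zero    a k = K.reflexive (≡.cong (extend a) (ℤ.+-identityʳ k))
  extend-shift (suc m) a k = begin
    extend (shift (suc m) a) (k ℤ.+ + suc m)             ≡⟨ ≡.cong (extend (shift (suc m) a)) k+1+m≡1+[k+m] ⟩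
    extend (shift (suc m) a) (ℤ.suc (k ℤ.+ + m))         ≈⟨ extend-suc (k ℤ.+ + m) ⟩
    extend (shift m a) (k ℤ.+ + m)                       ≈⟨ extend-shift m a k ⟩
    extend a k                                           ∎
    where
    k+1+m≡1+[k+m] : k ℤ.+ + suc m ≡ ℤ.suc (k ℤ.+ + m)
    k+1+m≡1+[k+m] = ≡.trans (≡.sym (ℤ.+-assoc k (+ 1) (+ m)))
      (≡.trans (≡.cong (ℤ._+ + m) (ℤ.+-comm k (+ 1))) (ℤ.+-assoc (+ 1) k (+ m)))
    extend-suc : ∀ j → extend (shift (suc m) a) (ℤ.suc j) ≈ extend (shift m a) j
    extend-suc (+ i)        = K.refl
    extend-suc -[1+ zero ]  = K.refl
    extend-suc -[1+ suc i ] = K.refl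

  -- Brings `f` to the pole bound of a sum. Together with the mirrored `coeff-shiftˡ` it gives both
  -- summands the same bound `pole f + pole g`.
  coeff-shiftʳ : ∀ f m k → coeff f k ≈ extend (shift m (series f)) (k ℤ.+ + (pole f ℕ.+ m))
  coeff-shiftʳ f m k = begin
    coeff f k                                                ≈⟨ extend-shift m (series f) (k ℤ.+ + pole f) ⟨
    extend (shift m (series f)) (k ℤ.+ + pole f ℤ.+ + m)     ≡⟨ ≡.cong (extend (shift m (series f))) (ℤ.+-assoc k _ _) ⟩
    extend (shift m (series f)) (k ℤ.+ + (pole f ℕ.+ m))     ∎

  coeff-shiftˡ : ∀ f m k → coeff f k ≈ extend (shift m (series f)) (k ℤ.+ + (m ℕ.+ pole f))
  coeff-shiftˡ f m k = K.trans (coeff-shiftʳ f m k)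
    (K.reflexive (≡.cong (λ n → extend (shift m (series f)) (k ℤ.+ + n)) (ℕ.+-comm (pole f) m)))

  coeff-+ : ∀ f g k → coeff (f L.+ g) k ≈ coeff f k + coeff g k
  coeff-+ f g k = K.trans (extend-+ _ _ (k ℤ.+ + (pole f ℕ.+ pole g)))
    (K.sym (+-cong (coeff-shiftʳ f (pole g) k) (coeff-shiftˡ g (pole f) k)))

  coeff-neg : ∀ f k → coeff (L.- f) k ≈ - coeff f k
  coeff-neg f k = extend-neg (series f) (k ℤ.+ + pole f)

  -- Cross-multiplication of fractions whose denominators are powers of t. With the converse below
  -- it reduces equality of Laurent series to equality of power series.
  ≈ᴸ⇒≈ˢ : ∀ f g → f ≈ᴸ g → shift (pole g) (series f) ≈ˢ shift (pole f) (series g)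
  ≈ᴸ⇒≈ˢ f g f≈g i =
    ≡.subst (λ j → extend (shift (pole g) (series f)) j ≈ extend (shift (pole f) (series g)) j)
      k+n≡i
      (begin
        extend (shift (pole g) (series f)) (k ℤ.+ + n) ≈⟨ coeff-shiftʳ f (pole g) k ⟨
        coeff f k                                      ≈⟨ f≈g k ⟩
        coeff g k                                      ≈⟨ coeff-shiftˡ g (pole f) k ⟩
        extend (shift (pole f) (series g)) (k ℤ.+ + n) ∎)
    where
    n = pole f ℕ.+ pole g
    -- The exponent whose coefficient sits at index `i` once both series have pole bound `n`.
    k = + i ℤ.- + n
    k+n≡i : k ℤ.+ + n ≡ + i
    k+n≡i = ≡.trans (ℤ.+-assoc (+ i) (ℤ.- + n) (+ n))
      (≡.trans (≡.cong (λ j → + i ℤ.+ j) (ℤ.+-inverseˡ (+ n))) (ℤ.+-identityʳ (+ i)))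

  ≈ˢ⇒≈ᴸ : ∀ f g → shift (pole g) (series f) ≈ˢ shift (pole f) (series g) → f ≈ᴸ g
  ≈ˢ⇒≈ᴸ f g f≈g k = begin
    coeff f k                                                         ≈⟨ coeff-shiftʳ f (pole g) k ⟩
    extend (shift (pole g) (series f)) (k ℤ.+ + (pole f ℕ.+ pole g))  ≈⟨ extend-cong f≈g (k ℤ.+ + (pole f ℕ.+ pole g)) ⟩
    extend (shift (pole f) (series g)) (k ℤ.+ + (pole f ℕ.+ pole g))  ≈⟨ coeff-shiftˡ g (pole f) k ⟨
    coeff g k                                                         ∎

  laurent-cong : ∀ k {a b} → a ≈ˢ b → laurent k a ≈ᴸ laurent k b
  laurent-cong k a≈b j = extend-cong a≈b (j ℤ.+ + k)

  laurent-injective : ∀ k {a b} → laurent k a ≈ᴸ laurent k b → a ≈ˢ b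
  laurent-injective k {a} {b} a≈b i = begin
    a i                         ≈⟨ shift-by k a i ⟨
    shift k a (k ℕ.+ i)         ≈⟨ ≈ᴸ⇒≈ˢ (laurent k a) (laurent k b) a≈b (k ℕ.+ i) ⟩
    shift k b (k ℕ.+ i)         ≈⟨ shift-by k b i ⟩
    b i                         ∎
    where
    shift-by : ∀ k a i → shift k a (k ℕ.+ i) ≈ a i
    shift-by zero    a i = K.refl
    shift-by (suc k) a i = shift-by k a i

  laurent-shift : ∀ m k a → laurent k a ≈ᴸ laurent (m ℕ.+ k) (shift m a)
  laurent-shift m k a = coeff-shiftˡ (laurent k a) m

  laurent-+ : ∀ k a b → laurent k a L.+ laurent k b ≈ᴸ laurent k (λ i → a i + b i)
  laurent-+ k a b j =
    K.trans (coeff-+ (laurent k a) (laurent k b) j) (K.sym (extend-+ a b (j ℤ.+ + k)))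

  +ᴸ-cong : ∀ f f′ g g′ → f ≈ᴸ f′ → g ≈ᴸ g′ → f L.+ g ≈ᴸ f′ L.+ g′
  +ᴸ-cong f f′ g g′ f≈f′ g≈g′ k = begin
    coeff (f L.+ g) k       ≈⟨ coeff-+ f g k ⟩
    coeff f k + coeff g k   ≈⟨ +-cong (f≈f′ k) (g≈g′ k) ⟩
    coeff f′ k + coeff g′ k ≈⟨ coeff-+ f′ g′ k ⟨
    coeff (f′ L.+ g′) k     ∎

  -ᴸ-cong : ∀ f g → f ≈ᴸ g → L.- f ≈ᴸ L.- g
  -ᴸ-cong f g f≈g k = begin
    coeff (L.- f) k ≈⟨ coeff-neg f k ⟩
    - coeff f k     ≈⟨ -‿cong (f≈g k) ⟩
    - coeff g k     ≈⟨ coeff-neg g k ⟨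
    coeff (L.- g) k ∎

  shift-⊛ : ∀ m n a b → shift m a ⊛ shift n b ≈ˢ shift (m ℕ.+ n) (a ⊛ b)
  shift-⊛ m n a b i = begin
    (shift m a ⊛ shift n b) i  ≈⟨ shift-⊛ˡ m a (shift n b) i ⟩
    shift m (a ⊛ shift n b) i  ≈⟨ shift-cong m (shift-⊛ʳ n a b) i ⟩
    shift m (shift n (a ⊛ b)) i ≈⟨ shift-+ m n (a ⊛ b) i ⟨
    shift (m ℕ.+ n) (a ⊛ b) i  ∎

  -- The cross-multiplied equations of the two factors are multiplied, and the shifts are pulled out
  -- of the convolution.
  *ᴸ-cong : ∀ f f′ g g′ → f ≈ᴸ f′ → g ≈ᴸ g′ → f L.* g ≈ᴸ f′ L.* g′
  *ᴸ-cong f f′ g g′ f≈f′ g≈g′ = ≈ˢ⇒≈ᴸ (f L.* g) (f′ L.* g′) λ i → begin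
    shift (pole f′ ℕ.+ pole g′) (series f ⊛ series g) i           ≈⟨ shift-⊛ (pole f′) (pole g′) _ _ i ⟨
    (shift (pole f′) (series f) ⊛ shift (pole g′) (series g)) i   ≈⟨ ⊛-cong (≈ᴸ⇒≈ˢ f f′ f≈f′) (≈ᴸ⇒≈ˢ g g′ g≈g′) i ⟩
    (shift (pole f) (series f′) ⊛ shift (pole g) (series g′)) i   ≈⟨ shift-⊛ (pole f) (pole g) _ _ i ⟩
    shift (pole f ℕ.+ pole g) (series f′ ⊛ series g′) i           ∎

  open RawSemiringDefinitions L.rawSemiring using () renaming (_^_ to _^ᴸ_)
  open Exp semiring using (_^_)

  laurent-^ : ∀ n a → laurent 0 a ^ᴸ n ≈ᴸ laurent 0 (a ^ˢ n)
  laurent-^ zero    a = ≈ᴸ-refl {L.1#}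
  laurent-^ (suc n) a =
    *ᴸ-cong (laurent 0 a) (laurent 0 a) (laurent 0 a ^ᴸ n) (laurent 0 (a ^ˢ n))
      (≈ᴸ-refl {laurent 0 a}) (laurent-^ n a)

  -- The coefficient c of t⁻ᵏ in f may vanish.
  record Leading (k : ℕ) (c : Carrier) (f : Laurent K) : Set (κ ⊔ ℓ) where
    constructor leading
    field
      expansion : PowerSeries
      ≈expansion : f ≈ᴸ laurent k expansion
      head≈      : expansion 0 ≈ c

  -- Both soundness lemmas end here: an equation between series forces an equation in the residue
  -- field that fails.
  leading-unique : ∀ {k c d f g} → Leading k c f → Leading k d g → f ≈ᴸ g → c ≈ d
  leading-unique {k} (leading a f≈a a₀≈c) (leading b g≈b b₀≈d) f≈g =
    K.trans (K.sym a₀≈c) (K.trans (laurent-injective k a≈b 0) b₀≈d)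
    where
    a≈b : laurent k a ≈ᴸ laurent k b
    a≈b j = K.trans (K.sym (f≈a j)) (K.trans (f≈g j) (g≈b j))

  leading-cong : ∀ {k c d f} → c ≈ d → Leading k c f → Leading k d f
  leading-cong c≈d (leading a f≈a a₀≈c) = leading a f≈a (K.trans a₀≈c c≈d)

  leading-+ : ∀ {k c d f g} → Leading k c f → Leading k d g → Leading k (c + d) (f L.+ g)
  leading-+ {k} {f = f} {g} (leading a f≈a a₀≈c) (leading b g≈b b₀≈d) =
    leading (λ i → a i + b i)
      (≈ᴸ-trans {f L.+ g} {laurent k a L.+ laurent k b}
        (+ᴸ-cong f (laurent k a) g (laurent k b) f≈a g≈b) (laurent-+ k a b))
      (+-cong a₀≈c b₀≈d)

  leading-neg : ∀ {k c f} → Leading k c f → Leading k (- c) (L.- f)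
  leading-neg {k} {f = f} (leading a f≈a a₀≈c) =
    leading (λ i → - a i) (-ᴸ-cong f (laurent k a) f≈a) (-‿cong a₀≈c)

  leading-1 : Leading 0 1# L.1#
  leading-1 = leading (constant 1#) (≈ᴸ-refl {L.1#}) K.refl

  leading-* : ∀ {k l c d f g} → Leading k c f → Leading l d g →
              Leading (k ℕ.+ l) (c * d) (f L.* g)
  leading-* {k} {l} {f = f} {g} (leading a f≈a a₀≈c) (leading b g≈b b₀≈d) =
    leading (a ⊛ b) (*ᴸ-cong f (laurent k a) g (laurent l b) f≈a g≈b)
      (K.trans (⊛-head a b) (*-cong a₀≈c b₀≈d))

  leading-^ : ∀ n {k c f} → Leading k c f → Leading (n ℕ.* k) (c ^ n) (f ^ᴸ n)
  leading-^ zero    _  = leading-1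
  leading-^ (suc n) fc = leading-* fc (leading-^ n fc)

  -- Lets `leading-+`, which asks for equal orders, absorb a term of smaller pole order: such a term
  -- contributes zero.
  leading-raise : ∀ {k l c f} → k ℕ.< l → Leading k c f → Leading l 0# f
  leading-raise {k} {f = f} k<l (leading a f≈a _)
    with m , refl ← ℕ.m≤n⇒∃[o]m+o≡n k<l
    rewrite ℕ.+-comm k m =
    leading (shift (suc m) a)
      (≈ᴸ-trans {f} {laurent k a} f≈a (laurent-shift (suc m) k a)) K.refl

-- Finite fields: an exponent `N` with aᴺ = a for all a.

module FiniteField {c ℓ : Level} {q : ℕ} (K : CommutativeRing c ℓ)
                   (isField : IsFieldOfOrder q K) where
  open CommutativeRing K hiding (refl; sym; trans)
  private module K = CommutativeRing K
  open IsFieldOfOrder isField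
  open Exp semiring
  open import Relation.Binary.Reasoning.Setoid setoid
  private module order = Inverse order

  to-injective : ∀ {a b} → order.to a ≡ order.to b → a ≈ b
  to-injective {a} {b} eq = begin
    a                         ≈⟨ order.strictlyInverseʳ a ⟨
    order.from (order.to a)   ≡⟨ ≡.cong order.from eq ⟩
    order.from (order.to b)   ≈⟨ order.strictlyInverseʳ b ⟩
    b                         ∎

  _≟_ : ∀ a b → Dec (a ≈ b)
  a ≟ b = map′ to-injective order.to-cong (order.to a ≟ᶠ order.to b)

  *-cancelˡ-nonZero : ∀ {a b c} → a ≉ 0# → a * b ≈ a * c → b ≈ c
  *-cancelˡ-nonZero {a} {b} {c} a≉0 ab≈ac
    with u , au≈1 ← inverse a a≉0 = begin
    b             ≈⟨ lemma b ⟨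
    u * (a * b)   ≈⟨ *-congˡ ab≈ac ⟩
    u * (a * c)   ≈⟨ lemma c ⟩
    c             ∎
    where
    lemma : ∀ x → u * (a * x) ≈ x
    lemma x = begin
      u * (a * x) ≈⟨ *-assoc u a x ⟨
      u * a * x   ≈⟨ *-congʳ (K.trans (*-comm u a) au≈1) ⟩
      1# * x      ≈⟨ *-identityˡ x ⟩
      x           ∎

  *-nonZero : ∀ {a b} → a ≉ 0# → b ≉ 0# → a * b ≉ 0#
  *-nonZero a≉0 b≉0 ab≈0 = b≉0 (*-cancelˡ-nonZero a≉0 (K.trans ab≈0 (K.sym (zeroʳ _))))

  ^-nonZero : ∀ {a} n → a ≉ 0# → a ^ n ≉ 0#
  ^-nonZero zero    a≉0 = 1≉0
  ^-nonZero (suc n) a≉0 = *-nonZero a≉0 (^-nonZero n a≉0)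

  1^n≈1 : ∀ n → 1# ^ n ≈ 1#
  1^n≈1 zero    = K.refl
  1^n≈1 (suc n) = K.trans (*-identityˡ _) (1^n≈1 n)

  n∣m! : ∀ {n m} → n ≢ 0 → n ℕ.≤ m → n ∣ m !
  n∣m! {zero}  n≢0 _   = contradiction refl n≢0
  n∣m! {suc n} _   n≤m = ∣-trans (m∣m*n (n !)) (m≤n⇒m!∣n! n≤m)

  -- By the pigeonhole principle aᵈ = 1 for some 0 < d ≤ q, and such d divide q!.
  a^q!≈1 : ∀ {a} → a ≉ 0# → a ^ (q !) ≈ 1#
  a^q!≈1 {a} a≉0
    with i , j , i<j , eq ← pigeonhole (ℕ.n<1+n q) (λ i → order.to (a ^ toℕ i))
    with d , i+d≡j ← ℕ.m≤n⇒∃[o]m+o≡n (ℕ.<⇒≤ i<j)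
    with divides k q!≡k*d ← n∣m! {d} {q}
      (λ { refl → ℕ.<-irrefl (≡.trans (≡.sym (ℕ.+-identityʳ _)) i+d≡j) i<j })
      (ℕ.≤-trans (≡.subst (d ℕ.≤_) i+d≡j (ℕ.m≤n+m d (toℕ i))) (ℕ.s≤s⁻¹ (toℕ<n j)))
    = begin
    a ^ (q !)       ≡⟨ ≡.cong (a ^_) (≡.trans q!≡k*d (ℕ.*-comm k d)) ⟩
    a ^ (d ℕ.* k)   ≈⟨ ^-assocʳ a d k ⟨
    (a ^ d) ^ k     ≈⟨ ^-congˡ k a^d≈1 ⟩
    1# ^ k          ≈⟨ 1^n≈1 k ⟩
    1#              ∎
    where
    a^d≈1 : a ^ d ≈ 1#
    a^d≈1 = *-cancelˡ-nonZero (^-nonZero (toℕ i) a≉0) (begin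
      a ^ toℕ i * a ^ d     ≈⟨ ^-homo-* a (toℕ i) d ⟨
      a ^ (toℕ i ℕ.+ d)     ≡⟨ ≡.cong (a ^_) i+d≡j ⟩
      a ^ toℕ j             ≈⟨ to-injective eq ⟨
      a ^ toℕ i             ≈⟨ *-identityʳ _ ⟨
      a ^ toℕ i * 1#        ∎)

  -- `N` is q! + 1; with q! the pigeonhole principle suffices, and the additional factor covers a =
  -- 0. The form `suc (suc M)` shows N ≥ 2, as `solve` requires.
  M N : ℕ
  M = ℕ.pred (q !)
  N = suc (suc M)

  a^N≈a : ∀ a → a ^ N ≈ a
  a^N≈a a with a ≟ 0#
  ... | yes a≈0 = K.trans (*-congʳ a≈0) (K.trans (zeroˡ _) (K.sym a≈0))
  ... | no  a≉0 = begin
    a * a ^ suc M   ≡⟨ ≡.cong (λ n → a * a ^ n) (ℕ.suc-pred (q !) {{q ℕ.!≢0}}) ⟩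
    a * a ^ (q !)   ≈⟨ *-congˡ (a^q!≈1 a≉0) ⟩
    a * 1#          ≈⟨ *-identityʳ a ⟩
    a               ∎

-- The ring equations certifying integrality and nonintegrality.

module Witnesses {c ℓ : Level} (R : RawRing c ℓ) (N : ℕ) where
  open RawRing R
  open RawSemiringDefinitions rawSemiring using (_^_)

  ℘ : Carrier → Carrier
  ℘ x = x ^ N + - x

  IntegralBy : Carrier → Carrier → Set ℓ
  IntegralBy x y = (℘ x + - 1#) * (℘ y + - 1#) ≈ 1#

  -- Integrality of `y` must itself be expressed by an equation, and `z` is its witness.
  NonintegralBy : Carrier → Carrier → Carrier → Set ℓ
  NonintegralBy x y z = x * ℘ y ≈ 1# × IntegralBy y z

-- Soundness and completeness of the certificates over a finite field.

module Integrality {c ℓ : Level} {q : ℕ} (K : CommutativeRing c ℓ)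
                   (isField : IsFieldOfOrder q K) where
  open CommutativeRing K hiding (refl; sym; trans)
  private module K = CommutativeRing K
  open IsFieldOfOrder isField
  open FiniteField K isField
  open Series K
  open Exp semiring using (_^_)
  open RingProperties ring
  open import Relation.Binary.Reasoning.Setoid setoid
  private module L = RawRing (laurentRawRing K)
  open RawSemiringDefinitions L.rawSemiring using () renaming (_^_ to _^ᴸ_)
  open Witnesses (laurentRawRing K) N

  Normalisation : Laurent K → Set _
  Normalisation f = (∃ λ a → f ≈ᴸ laurent 0 a) ⊎
                    (∃₂ λ k a → f ≈ᴸ laurent (suc k) a × a 0 ≉ 0#)

  normalisation-cong : ∀ {f g} → f ≈ᴸ g → Normalisation g → Normalisation f
  normalisation-cong {f} {g} f≈g (inj₁ (a , g≈a)) =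
    inj₁ (a , ≈ᴸ-trans {f} {g} f≈g g≈a)
  normalisation-cong {f} {g} f≈g (inj₂ (k , a , g≈a , a₀≉0)) =
    inj₂ (k , a , ≈ᴸ-trans {f} {g} f≈g g≈a , a₀≉0)

  -- The recorded pole is only a bound, so vanishing leading coefficients are stripped until the
  -- bound is zero or the coefficient is nonzero; this uses decidable equality in `K`.
  normalise : ∀ f → Normalisation f
  normalise (laurent p a) = go p a
    where
    go : ∀ p a → Normalisation (laurent p a)
    go zero    a = inj₁ (a , ≈ᴸ-refl {laurent 0 a})
    go (suc p) a with a 0 ≟ 0#
    ... | no  a₀≉0 = inj₂ (p , a , ≈ᴸ-refl {laurent (suc p) a} , a₀≉0)
    ... | yes a₀≈0 = normalisation-cong a≈tail (go p (tail a))
      where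
      -- As `a 0` vanishes, `a` is t times its tail, and the factor t lowers the pole bound by one.
      a≈tail : laurent (suc p) a ≈ᴸ laurent p (tail a)
      a≈tail j = K.trans
        (laurent-cong (suc p) (λ { zero → a₀≈0 ; (suc i) → K.refl }) j)
        (K.sym (laurent-shift 1 p (tail a) j))

  laurent0⇒𝒪 : ∀ {f a} → f ≈ᴸ laurent 0 a → 𝒪 f
  laurent0⇒𝒪 f≈a k = f≈a -[1+ k ]

  pole⇒¬𝒪 : ∀ {f k a} → f ≈ᴸ laurent (suc k) a → a 0 ≉ 0# → ¬ 𝒪 f
  pole⇒¬𝒪 {f} {k} {a} f≈a a₀≉0 f∈𝒪 = a₀≉0 (begin
    a 0                              ≡⟨ ≡.cong (extend a) (ℤ.n⊖n≡0 (suc k)) ⟨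
    coeff (laurent (suc k) a) -[1+ k ] ≈⟨ f≈a -[1+ k ] ⟨
    coeff f -[1+ k ]                 ≈⟨ f∈𝒪 k ⟩
    0#                               ∎)

  𝒪⇒laurent0 : ∀ {f} → 𝒪 f → ∃ λ a → f ≈ᴸ laurent 0 a
  𝒪⇒laurent0 {f} f∈𝒪 with normalise f
  ... | inj₁ p                    = p
  ... | inj₂ (k , a , f≈a , a₀≉0) = contradiction f∈𝒪 (pole⇒¬𝒪 {f} f≈a a₀≉0)

  𝒪? : ∀ f → Dec (𝒪 f)
  𝒪? f with normalise f
  ... | inj₁ (a , f≈a)            = yes (laurent0⇒𝒪 {f} {a} f≈a)
  ... | inj₂ (k , a , f≈a , a₀≉0) = no (pole⇒¬𝒪 {f} f≈a a₀≉0)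

  -- The constant term is cᴺ - c, zero by the choice of `N`.
  leading-℘-integral : ∀ {f c} → Leading 0 c f → Leading 0 0# (℘ f)
  leading-℘-integral {f} {c} fc =
    leading-cong (K.trans (+-congʳ (a^N≈a c)) (-‿inverseʳ c))
      (leading-+
        (≡.subst (λ k → Leading k (c ^ N) (f ^ᴸ N)) (ℕ.*-zeroʳ N) (leading-^ N fc))
        (leading-neg fc))

  -- Since N ≥ 2, the pole of fᴺ has larger order than that of f, so only cᴺ = c survives.
  leading-℘-pole : ∀ {f k c} → Leading (suc k) c f → Leading (N ℕ.* suc k) c (℘ f)
  leading-℘-pole {f} {k} {c} fc =
    leading-cong (K.trans (+-cong (a^N≈a c) -0#≈0#) (+-identityʳ c))
      (leading-+ (leading-^ N fc)
        (leading-neg (leading-raise (ℕ.m<m+n (suc k) ℕ.z<s) fc)))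

  leading-℘-1 : ∀ f → 𝒪 f × Leading 0 (- 1#) (℘ f L.+ L.- L.1#) ⊎
                      ¬ 𝒪 f × ∃₂ λ k c → c ≉ 0# × Leading (suc k) c (℘ f L.+ L.- L.1#)
  leading-℘-1 f with normalise f
  ... | inj₁ (a , f≈a) = inj₁ (laurent0⇒𝒪 {f} {a} f≈a , leading-cong (+-identityˡ _)
    (leading-+ (leading-℘-integral (leading a f≈a K.refl)) (leading-neg leading-1)))
  ... | inj₂ (k , a , f≈a , a₀≉0) = inj₂ (pole⇒¬𝒪 {f} f≈a a₀≉0 , _ , a 0 , a₀≉0 ,
    leading-cong (K.trans (+-congˡ -0#≈0#) (+-identityʳ _))
      (leading-+ (leading-℘-pole (leading a f≈a K.refl))
        (leading-neg (leading-raise ℕ.z<s leading-1))))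

  -1≉0 : - 1# ≉ 0#
  -1≉0 -1≈0 = 1≉0 (-‿injective (K.trans -1≈0 (K.sym -0#≈0#)))

  -1*-1≈1 : - 1# * - 1# ≈ 1#
  -1*-1≈1 = K.trans (-1*x≈-x (- 1#)) (-‿involutive 1#)

  -- If x were not integral, the first factor would have a pole, and the second is a unit of the
  -- valuation ring or has a pole too. The product then has a nonzero coefficient at a negative
  -- exponent, unlike 1.
  integral-sound : ∀ x y → IntegralBy x y → 𝒪 x
  integral-sound x y eq with leading-℘-1 x | leading-℘-1 y
  ... | inj₁ (x∈𝒪 , _) | _ = x∈𝒪
  ... | inj₂ (_ , k , c , c≉0 , xc) | inj₁ (_ , yd) =
    contradiction (leading-unique (leading-* xc yd) (leading-raise ℕ.z<s leading-1) eq)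
      (*-nonZero c≉0 -1≉0)
  ... | inj₂ (_ , k , c , c≉0 , xc) | inj₂ (_ , l , d , d≉0 , yd) =
    contradiction (leading-unique (leading-* xc yd) (leading-raise ℕ.z<s leading-1) eq)
      (*-nonZero c≉0 d≉0)

  -- For integral x and y the constant term of x ℘(y) is a multiple of that of ℘(y), which is zero.
  nonintegral-sound : ∀ x y z → NonintegralBy x y z → ¬ 𝒪 x
  nonintegral-sound x y z (x℘y≈1 , y-integral) x∈𝒪
    with a , x≈a ← 𝒪⇒laurent0 {x} x∈𝒪
    with b , y≈b ← 𝒪⇒laurent0 {y} (integral-sound y z y-integral) =
    1≉0 (K.trans
      (K.sym (leading-unique
        (leading-* (leading a x≈a K.refl) (leading-℘-integral (leading b y≈b K.refl)))
        leading-1 x℘y≈1))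
      (zeroʳ (a 0)))

  -- Applied with k = 0 to invert ℘(x) - 1, and with k > 0 to invert a series with a pole.
  *ᴸ-inverse : ∀ k a b f g → f ≈ᴸ laurent k a → g ≈ᴸ laurent 0 b →
               a ⊛ b ≈ˢ shift k (constant 1#) → f L.* g ≈ᴸ L.1#
  *ᴸ-inverse k a b f g f≈a g≈b ab≈tᵏ j = begin
    coeff (f L.* g) j                                   ≈⟨ *ᴸ-cong f (laurent k a) g (laurent 0 b) f≈a g≈b j ⟩
    coeff (laurent (k ℕ.+ 0) (a ⊛ b)) j                 ≈⟨ laurent-cong (k ℕ.+ 0) ab≈tᵏ j ⟩
    coeff (laurent (k ℕ.+ 0) (shift k (constant 1#))) j ≈⟨ laurent-shift k 0 (constant 1#) j ⟨
    coeff L.1# j                                        ∎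

  -1ᴸ-cancel : ∀ d f → f ≈ᴸ laurent 0 (λ i → d i + constant 1# i) → f L.+ L.- L.1# ≈ᴸ laurent 0 d
  -1ᴸ-cancel d f f≈d+1 j = begin
    coeff (f L.+ L.- L.1#) j
      ≈⟨ +ᴸ-cong f (laurent 0 d+1) (L.- L.1#) (L.- L.1#) f≈d+1 (≈ᴸ-refl {L.- L.1#}) j ⟩
    coeff (laurent 0 d+1 L.+ L.- L.1#) j
      ≈⟨ laurent-+ 0 d+1 (λ i → - constant 1# i) j ⟩
    coeff (laurent 0 (λ i → d+1 i - constant 1# i)) j
      ≈⟨ laurent-cong 0 (λ i → //-rightDividesʳ (constant 1# i) (d i)) j ⟩
    coeff (laurent 0 d) j ∎
    where
    d+1 : PowerSeries
    d+1 i = d i + constant 1# i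

  ℘-surjective : ∀ (e : PowerSeries) → e 0 ≈ 0# → ∃ λ y → ℘ (laurent 0 y) ≈ᴸ laurent 0 e
  ℘-surjective e e₀≈0 with y , eq ← solve M e e₀≈0 = y , λ j → begin
    coeff (℘ (laurent 0 y)) j
      ≈⟨ +ᴸ-cong (laurent 0 y ^ᴸ N) (laurent 0 (y ^ˢ N)) (L.- laurent 0 y) (L.- laurent 0 y)
           (laurent-^ N y) (≈ᴸ-refl {L.- laurent 0 y}) j ⟩
    coeff (laurent 0 (y ^ˢ N) L.+ L.- laurent 0 y) j
      ≈⟨ laurent-+ 0 (y ^ˢ N) (λ i → - y i) j ⟩
    coeff (laurent 0 (λ i → (y ^ˢ N) i - y i)) j
      ≈⟨ laurent-cong 0 eq j ⟩
    coeff (laurent 0 e) j ∎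

  -- The inverse `d` of a series with constant term -1 has constant term -1 as well, so
  -- `℘-surjective` applies to d + 1.
  head+1≈0 : ∀ b d → b 0 ≈ - 1# → b ⊛ d ≈ˢ constant 1# → d 0 + 1# ≈ 0#
  head+1≈0 b d b₀≈-1 bd≈1 = begin
    d 0 + 1#            ≈⟨ +-congˡ (bd≈1 0) ⟨
    d 0 + (b ⊛ d) 0     ≈⟨ +-congˡ (⊛-head b d) ⟩
    d 0 + b 0 * d 0     ≈⟨ +-congˡ (*-congʳ b₀≈-1) ⟩
    d 0 + - 1# * d 0    ≈⟨ +-congˡ (-1*x≈-x (d 0)) ⟩
    d 0 + - d 0         ≈⟨ -‿inverseʳ (d 0) ⟩
    0#                  ∎

  ℘-1-inverse : ∀ x → Leading 0 (- 1#) (℘ x L.+ L.- L.1#) → ∃ (IntegralBy x)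
  ℘-1-inverse x (leading b ℘x-1≈b b₀≈-1) =
    -- The constant term -1 is its own inverse. The wanted y satisfies ℘(y) - 1 = d.
    let d , bd≈1   = divide b (K.trans (*-congʳ b₀≈-1) -1*-1≈1) (constant 1#)
        y , ℘y≈d+1 = ℘-surjective (λ i → d i + constant 1# i) (head+1≈0 b d b₀≈-1 bd≈1)
    in laurent 0 y ,
       *ᴸ-inverse 0 b d (℘ x L.+ L.- L.1#) (℘ (laurent 0 y) L.+ L.- L.1#)
         ℘x-1≈b (-1ᴸ-cancel d (℘ (laurent 0 y)) ℘y≈d+1) bd≈1

  integral-complete : ∀ x → 𝒪 x → ∃ (IntegralBy x)
  integral-complete x x∈𝒪 with leading-℘-1 x
  ... | inj₁ (_ , ℘x-1) = ℘-1-inverse x ℘x-1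
  ... | inj₂ (x∉𝒪 , _)  = contradiction x∈𝒪 x∉𝒪

  pole-inverse : ∀ x k a → x ≈ᴸ laurent (suc k) a → a 0 ≉ 0# → ∃₂ (NonintegralBy x)
  pole-inverse x k a x≈a a₀≉0 =
    let u , a₀u≈1    = inverse (a 0) a₀≉0
        -- `e` is the inverse of x. It has zero constant term because k + 1 > 0, hence it is some
        -- ℘(y).
        e , ae≈tᵏ⁺¹  = divide a a₀u≈1 (shift (suc k) (constant 1#))
        y , ℘y≈e     = ℘-surjective e (*-cancelˡ-nonZero a₀≉0
                         (K.trans (K.sym (⊛-head a e)) (K.trans (ae≈tᵏ⁺¹ 0) (K.sym (zeroʳ (a 0))))))
        z , y-integral = integral-complete (laurent 0 y)
                           (laurent0⇒𝒪 {laurent 0 y} {y} (≈ᴸ-refl {laurent 0 y}))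
    in laurent 0 y , z ,
       *ᴸ-inverse (suc k) a e x (℘ (laurent 0 y)) x≈a ℘y≈e ae≈tᵏ⁺¹ ,
       y-integral

  nonintegral-complete : ∀ x → ¬ 𝒪 x → ∃₂ (NonintegralBy x)
  nonintegral-complete x x∉𝒪 with normalise x
  ... | inj₁ (a , x≈a) = contradiction (laurent0⇒𝒪 {x} {a} x≈a) x∉𝒪
  ... | inj₂ (k , a , x≈a , a₀≉0) = pole-inverse x k a x≈a a₀≉0

-- Formulas

module _ {a : Level} {A : Set a} where

  mutual
    -- The two languages share their function symbols; variables are renamed to make room for the
    -- witnesses.
    toRing : ∀ {n m} → (Fin n → Fin m) → Term 𝓛val A n → Term 𝓛ring A m
    toRing σ (var i)    = var (σ i)
    toRing σ (param c)  = param c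
    toRing σ (fun f ts) = fun f (toRings σ ts)

    toRings : ∀ {n m k} → (Fin n → Fin m) → Vec (Term 𝓛val A n) k → Vec (Term 𝓛ring A m) k
    toRings σ []       = []
    toRings σ (t ∷ ts) = toRing σ t ∷ toRings σ ts

  module _ {m : ℕ} where

    infixl 9 _+′_
    infixl 10 _*′_

    0″ 1″ -1″ : Term 𝓛ring A m
    0″  = fun zero′ []
    1″  = fun one′ []
    -1″ = fun neg′ (1″ ∷ [])

    _+′_ _*′_ : Term 𝓛ring A m → Term 𝓛ring A m → Term 𝓛ring A m
    s +′ t = fun add′ (s ∷ t ∷ [])
    s *′ t = fun mul′ (s ∷ t ∷ [])

    pow : Term 𝓛ring A m → ℕ → Term 𝓛ring A m
    pow t zero    = 1″
    pow t (suc n) = t *′ pow t n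

    ℘′ : ℕ → Term 𝓛ring A m → Term 𝓛ring A m
    ℘′ N t = pow t N +′ fun neg′ (t ∷ [])

    integralBy : ℕ → (s t : Term 𝓛ring A m) → Formula 𝓛ring A m
    integralBy N s t = (℘′ N s +′ -1″) *′ (℘′ N t +′ -1″) =′ 1″

    nonintegralBy : ℕ → (s t u : Term 𝓛ring A m) → Formula 𝓛ring A m
    nonintegralBy N s t u = s *′ ℘′ N t =′ 1″ ∧′ integralBy N t u

  -- Each atom in `𝒪′` receives the pair y, z that `NonintegralBy` calls for; `IntegralBy` takes the
  -- first of them.
  witnesses : ∀ {n} {φ : Formula 𝓛val A n} → QuantifierFree φ → ℕ
  witnesses (s =′ t)  = 0
  witnesses (rel R ts) = 2
  witnesses (¬′ p)    = witnesses p
  witnesses (p ∧′ q)  = witnesses p ℕ.+ witnesses q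
  witnesses (p ∨′ q)  = witnesses p ℕ.+ witnesses q
  witnesses (p ⇒′ q)  = witnesses p ℕ.+ witnesses q

  module _ (N : ℕ) {n m : ℕ} (σ : Fin n → Fin m) where

    -- The same replacement is made at positive and negative occurrences; it is faithful only under
    -- `guard`.
    body : {φ : Formula 𝓛val A n} (p : QuantifierFree φ) →
           (Fin (witnesses p) → Fin m) → Formula 𝓛ring A m
    body (s =′ t)            w = toRing σ s =′ toRing σ t
    body (rel 𝒪′ (t ∷ []))   w = integralBy N (toRing σ t) (var (w zero))
    body (¬′ p)              w = ¬′ body p w
    body (p ∧′ q)            w = body p (w ∘ (_↑ˡ witnesses q)) ∧′ body q (w ∘ (witnesses p ↑ʳ_))
    body (p ∨′ q)            w = body p (w ∘ (_↑ˡ witnesses q)) ∨′ body q (w ∘ (witnesses p ↑ʳ_))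
    body (p ⇒′ q)            w = body p (w ∘ (_↑ˡ witnesses q)) ⇒′ body q (w ∘ (witnesses p ↑ʳ_))

    -- The witnesses decide each atom 𝒪 t.  Equations are not decidable, and the
    -- guard imposes nothing on them.
    guard : {φ : Formula 𝓛val A n} (p : QuantifierFree φ) →
            (Fin (witnesses p) → Fin m) → Formula 𝓛ring A m
    -- An implication from a formula to itself is true in every raw structure, whereas `0″ =′ 0″`
    -- alone would require reflexivity of `_≈_`.
    guard (s =′ t)           w = 0″ =′ 0″ ⇒′ 0″ =′ 0″
    guard (rel 𝒪′ (t ∷ []))  w =
      integralBy N (toRing σ t) (var (w zero)) ∨′
      nonintegralBy N (toRing σ t) (var (w zero)) (var (w (suc zero)))
    -- The connectives of the formula are ignored: every atom is to be decided, whatever its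
    -- polarity.
    guard (¬′ p)             w = guard p w
    guard (p ∧′ q)           w = guard p (w ∘ (_↑ˡ witnesses q)) ∧′ guard q (w ∘ (witnesses p ↑ʳ_))
    guard (p ∨′ q)           w = guard p (w ∘ (_↑ˡ witnesses q)) ∧′ guard q (w ∘ (witnesses p ↑ʳ_))
    guard (p ⇒′ q)           w = guard p (w ∘ (_↑ˡ witnesses q)) ∧′ guard q (w ∘ (witnesses p ↑ʳ_))

    body-qf : ∀ {φ} (p : QuantifierFree φ) w → QuantifierFree (body p w)
    body-qf (s =′ t)          w = _ =′ _
    body-qf (rel 𝒪′ (t ∷ [])) w = _ =′ _
    body-qf (¬′ p)            w = ¬′ body-qf p w
    body-qf (p ∧′ q)          w = body-qf p _ ∧′ body-qf q _
    body-qf (p ∨′ q)          w = body-qf p _ ∨′ body-qf q _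
    body-qf (p ⇒′ q)          w = body-qf p _ ⇒′ body-qf q _

    guard-qf : ∀ {φ} (p : QuantifierFree φ) w → QuantifierFree (guard p w)
    guard-qf (s =′ t)          w = (_ =′ _) ⇒′ (_ =′ _)
    guard-qf (rel 𝒪′ (t ∷ [])) w = (_ =′ _) ∨′ ((_ =′ _) ∧′ (_ =′ _))
    guard-qf (¬′ p)            w = guard-qf p w
    guard-qf (p ∧′ q)          w = guard-qf p _ ∧′ guard-qf q _
    guard-qf (p ∨′ q)          w = guard-qf p _ ∧′ guard-qf q _
    guard-qf (p ⇒′ q)          w = guard-qf p _ ∧′ guard-qf q _

  ∃′^ : ∀ k {n} → Formula 𝓛ring A (k ℕ.+ n) → Formula 𝓛ring A n
  ∃′^ zero    φ = φ
  ∃′^ (suc k) φ = ∃′^ k (∃′ φ)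

  ∃′^-existential : ∀ k {n} {φ : Formula 𝓛ring A (k ℕ.+ n)} →
                    Existential φ → Existential (∃′^ k φ)
  ∃′^-existential zero    e = e
  ∃′^-existential (suc k) e = ∃′^-existential k (∃′ e)

  translateMatrix : ℕ → ∀ {n} {φ : Formula 𝓛val A n} → QuantifierFree φ → Formula 𝓛ring A n
  translateMatrix N {n} p = ∃′^ (witnesses p)
    (guard N (witnesses p ↑ʳ_) p (_↑ˡ n) ∧′ body N (witnesses p ↑ʳ_) p (_↑ˡ n))

  -- The original quantifiers stay outermost, so the witnesses may depend on the variables they
  -- bind.
  translate : ℕ → ∀ {n} {φ : Formula 𝓛val A n} → Existential φ → Formula 𝓛ring A n
  translate N (matrix p) = translateMatrix N p
  translate N (∃′ e)     = ∃′ (translate N e)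

  translate-existential : ∀ N {n} {φ : Formula 𝓛val A n} (e : Existential φ) →
                          Existential (translate N e)
  translate-existential N (matrix p) =
    ∃′^-existential (witnesses p) (matrix (guard-qf N _ p _ ∧′ body-qf N _ p _))
  translate-existential N (∃′ e)     = ∃′ (translate-existential N e)

-- Correctness of the translation, for any certificates that are sound and complete.

module Translation {a ℓ : Level} {A : Set a} (R : RawRing ℓ ℓ)
  (𝒪 : Pred (RawRing.Carrier R) ℓ) (name : A → RawRing.Carrier R) (N : ℕ)
  (𝒪?                   : ∀ x → Dec (𝒪 x))
  (integral-sound       : ∀ x y → Witnesses.IntegralBy R N x y → 𝒪 x)
  (integral-complete    : ∀ x → 𝒪 x → ∃ (Witnesses.IntegralBy R N x))
  (nonintegral-sound    : ∀ x y z → Witnesses.NonintegralBy R N x y z → ¬ 𝒪 x)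
  (nonintegral-complete : ∀ x → ¬ 𝒪 x → ∃₂ (Witnesses.NonintegralBy R N x)) where

  open Witnesses R N
  open RawRing R using (Carrier; _≈_; _+_; _*_; -_; 1#; rawSemiring)
  open RawSemiringDefinitions rawSemiring using (_^_)
  module Val  = Semantics (valuedStructure R 𝒪) name
  module Ring = Semantics (ringStructure R) name
  open Ring using (eval)

  eval-pow : ∀ {m} (ρ : Vec Carrier m) t n → eval ρ (pow t n) ≡ eval ρ t ^ n
  eval-pow ρ t zero    = refl
  eval-pow ρ t (suc n) = ≡.cong (eval ρ t *_) (eval-pow ρ t n)

  eval-℘ : ∀ {m} (ρ : Vec Carrier m) t → eval ρ (℘′ N t) ≡ ℘ (eval ρ t)
  eval-℘ ρ t = ≡.cong (_+ - eval ρ t) (eval-pow ρ t N)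

  -- An identity of types is available because the terms evaluate to identical elements; it permits
  -- rewriting without `_≈_` being a congruence.
  ⊨-integralBy : ∀ {m} (ρ : Vec Carrier m) s t →
    (ρ Ring.⊨ integralBy N s t) ≡ IntegralBy (eval ρ s) (eval ρ t)
  ⊨-integralBy ρ s t =
    ≡.cong₂ (λ x y → (x + - 1#) * (y + - 1#) ≈ 1#) (eval-℘ ρ s) (eval-℘ ρ t)

  ⊨-nonintegralBy : ∀ {m} (ρ : Vec Carrier m) s t u →
    (ρ Ring.⊨ nonintegralBy N s t u) ≡ NonintegralBy (eval ρ s) (eval ρ t) (eval ρ u)
  ⊨-nonintegralBy ρ s t u =
    ≡.cong₂ _×_ (≡.cong (λ x → eval ρ s * x ≈ 1#) (eval-℘ ρ t)) (⊨-integralBy ρ t u)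

  ⊨-∃′^ : ∀ k {n} (φ : Formula 𝓛ring A (k ℕ.+ n)) (ρ : Vec Carrier n) →
    (ρ Ring.⊨ ∃′^ k φ) ⇔ ∃ λ (ws : Vec Carrier k) → ws ++ ρ Ring.⊨ φ
  ⊨-∃′^ zero    φ ρ = mk⇔ ([] ,_) λ { ([] , h) → h }
  ⊨-∃′^ (suc k) φ ρ = mk⇔
    (λ h → let ws , x , h′ = Equivalence.to (⊨-∃′^ k (∃′ φ) ρ) h in x ∷ ws , h′)
    (λ { (x ∷ ws , h) → Equivalence.from (⊨-∃′^ k (∃′ φ) ρ) (ws , x , h) })

  atomWitness : ∀ x → ∃₂ λ y z → IntegralBy x y ⊎ NonintegralBy x y z
  atomWitness x with 𝒪? x
  -- Only `y` is constrained in this alternative; it is repeated as a default for the second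
  -- witness.
  ... | yes x∈𝒪 = let y , h = integral-complete x x∈𝒪 in y , y , inj₁ h
  ... | no  x∉𝒪 = let y , z , h = nonintegral-complete x x∉𝒪 in y , z , inj₂ h

  -- The choice depends on the values of the terms alone, so the guard can be met whether or not the
  -- formula holds.
  witnessVector : ∀ {n} (ρ : Vec Carrier n) {φ} (p : QuantifierFree φ) → Vec Carrier (witnesses p)
  witnessVector ρ (s =′ t)          = []
  witnessVector ρ (rel 𝒪′ (t ∷ [])) =
    let y , z , _ = atomWitness (Val.eval ρ t) in y ∷ z ∷ []
  witnessVector ρ (¬′ p)            = witnessVector ρ p
  witnessVector ρ (p ∧′ q)          = witnessVector ρ p ++ witnessVector ρ q
  witnessVector ρ (p ∨′ q)          = witnessVector ρ p ++ witnessVector ρ q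
  witnessVector ρ (p ⇒′ q)          = witnessVector ρ p ++ witnessVector ρ q

  module _ {n m : ℕ} (ρ : Vec Carrier n) (ρ′ : Vec Carrier m) (σ : Fin n → Fin m)
           (σ-agree : ∀ i → lookup ρ′ (σ i) ≡ lookup ρ i) where

    mutual
      eval-toRing : ∀ t → eval ρ′ (toRing σ t) ≡ Val.eval ρ t
      eval-toRing (var i)    = σ-agree i
      eval-toRing (param c)  = refl
      eval-toRing (fun f ts) = ≡.cong (ringFun R f) (evals-toRings ts)

      evals-toRings : ∀ {k} (ts : Vec _ k) → Ring.evals ρ′ (toRings σ ts) ≡ Val.evals ρ ts
      evals-toRings []       = refl
      evals-toRings (t ∷ ts) = ≡.cong₂ _∷_ (eval-toRing t) (evals-toRings ts)

    ⊨-atom-integral : ∀ t u →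
      (ρ′ Ring.⊨ integralBy N (toRing σ t) (var u)) ≡ IntegralBy (Val.eval ρ t) (lookup ρ′ u)
    ⊨-atom-integral t u = ≡.trans (⊨-integralBy ρ′ (toRing σ t) (var u))
      (≡.cong (λ x → IntegralBy x (lookup ρ′ u)) (eval-toRing t))

    ⊨-atom-nonintegral : ∀ t u v →
      (ρ′ Ring.⊨ nonintegralBy N (toRing σ t) (var u) (var v)) ≡
      NonintegralBy (Val.eval ρ t) (lookup ρ′ u) (lookup ρ′ v)
    ⊨-atom-nonintegral t u v = ≡.trans (⊨-nonintegralBy ρ′ (toRing σ t) (var u) (var v))
      (≡.cong (λ x → NonintegralBy x (lookup ρ′ u) (lookup ρ′ v)) (eval-toRing t))

    -- Under the guard each atom is equivalent to its replacement, and an equivalence, unlike an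
    -- implication, passes through `¬′` and `⇒′`.
    ⊨-body : ∀ {φ} (p : QuantifierFree φ) w → ρ′ Ring.⊨ guard N σ p w →
             (ρ Val.⊨ φ) ⇔ (ρ′ Ring.⊨ body N σ p w)
    ⊨-body (s =′ t) w _
      rewrite eval-toRing s | eval-toRing t = mk⇔ id id
    ⊨-body (rel 𝒪′ (t ∷ [])) w (inj₁ h) = mk⇔
      (λ _ → h)
      (λ h → integral-sound _ _ (≡.subst id (⊨-atom-integral t (w zero)) h))
    -- Here the guard refutes membership, so the forward direction is vacuous; the converse is
    -- soundness as before.
    ⊨-body (rel 𝒪′ (t ∷ [])) w (inj₂ h) = mk⇔
      (λ t∈𝒪 → contradiction t∈𝒪
        (nonintegral-sound _ _ _ (≡.subst id (⊨-atom-nonintegral t (w zero) (w (suc zero))) h)))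
      (λ h → integral-sound _ _ (≡.subst id (⊨-atom-integral t (w zero)) h))
    ⊨-body (¬′ p) w g =
      let P = ⊨-body p w g in
      mk⇔ (_∘ Equivalence.from P) (_∘ Equivalence.to P)
    ⊨-body (p ∧′ q) w (g , h) = ⊨-body p _ g ×-⇔ ⊨-body q _ h
    ⊨-body (p ∨′ q) w (g , h) = ⊨-body p _ g ⊎-⇔ ⊨-body q _ h
    ⊨-body (p ⇒′ q) w (g , h) =
      let P = ⊨-body p _ g ; Q = ⊨-body q _ h in
      mk⇔ (λ f → Equivalence.to Q ∘ f ∘ Equivalence.from P)
          (λ f → Equivalence.from Q ∘ f ∘ Equivalence.to P)

    ⊨-guard : ∀ {φ} (p : QuantifierFree φ) w →
              (∀ i → lookup ρ′ (w i) ≡ lookup (witnessVector ρ p) i) →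
              ρ′ Ring.⊨ guard N σ p w
    ⊨-guard-++ : ∀ {φ ψ} (p : QuantifierFree φ) (q : QuantifierFree ψ) w →
              (∀ i → lookup ρ′ (w i) ≡ lookup (witnessVector ρ p ++ witnessVector ρ q) i) →
              (ρ′ Ring.⊨ guard N σ p (w ∘ (_↑ˡ witnesses q))) ×
              (ρ′ Ring.⊨ guard N σ q (w ∘ (witnesses p ↑ʳ_)))
    ⊨-guard-++ p q w eq =
      ⊨-guard p _ (λ i → ≡.trans (eq (i ↑ˡ witnesses q)) (lookup-++ˡ (witnessVector ρ p) _ i)) ,
      ⊨-guard q _ (λ i → ≡.trans (eq (witnesses p ↑ʳ i)) (lookup-++ʳ (witnessVector ρ p) _ i))
    ⊨-guard (s =′ t)          w eq = id
    ⊨-guard (rel 𝒪′ (t ∷ [])) w eq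
      with h ← proj₂ (proj₂ (atomWitness (Val.eval ρ t)))
      rewrite ⊨-atom-integral t (w zero) | ⊨-atom-nonintegral t (w zero) (w (suc zero))
            | eq zero | eq (suc zero) = h
    ⊨-guard (¬′ p)            w eq = ⊨-guard p w eq
    ⊨-guard (p ∧′ q)          w eq = ⊨-guard-++ p q w eq
    ⊨-guard (p ∨′ q)          w eq = ⊨-guard-++ p q w eq
    ⊨-guard (p ⇒′ q)          w eq = ⊨-guard-++ p q w eq

  -- Forwards, the witnesses computed from `ρ` satisfy the guard. Backwards, the given witnesses are
  -- arbitrary, but the guard they satisfy suffices for `⊨-body`.
  ⊨-translate : ∀ {n} {φ : Formula 𝓛val A n} (e : Existential φ) (ρ : Vec Carrier n) →
                (ρ Val.⊨ φ) ⇔ (ρ Ring.⊨ translate N e)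
  ⊨-translate (matrix p) ρ = mk⇔
    (λ h → let ws = witnessVector ρ p
               g  = ⊨-guard ρ (ws ++ ρ) _ (lookup-++ʳ ws ρ) p _ (lookup-++ˡ ws ρ)
           in Equivalence.from (⊨-∃′^ (witnesses p) _ ρ)
                (ws , g , Equivalence.to (⊨-body ρ (ws ++ ρ) _ (lookup-++ʳ ws ρ) p _ g) h))
    (λ h → let ws , g , b = Equivalence.to (⊨-∃′^ (witnesses p) _ ρ) h
           in Equivalence.from (⊨-body ρ (ws ++ ρ) _ (lookup-++ʳ ws ρ) p _ g) b)
  ⊨-translate (∃′ e) ρ = mk⇔
    (λ (x , h) → x , Equivalence.to (⊨-translate e (x ∷ ρ)) h)
    (λ (x , h) → x , Equivalence.from (⊨-translate e (x ∷ ρ)) h)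

proposition3p3 : ∀ {ℓ c : Level} (q : ℕ) → IsPrimePower q →
    (K : CommutativeRing ℓ ℓ) → IsFieldOfOrder q K →
    (C : Pred (Laurent K) c) → IsSubfield (laurentRawRing K) C →
    (n : ℕ) (α : Formula 𝓛val (∃ C) n) → Existential α →
    ∃ λ (β : Formula 𝓛ring (∃ C) n) →
    Existential β × valDefinedSet K C α ≐ ringDefinedSet K C β
proposition3p3 q _ K isField C _ n α α-existential =
  translate N α-existential , translate-existential N α-existential ,
  (λ {ρ} → Equivalence.to (⊨-translate α-existential ρ)) ,
  (λ {ρ} → Equivalence.from (⊨-translate α-existential ρ))
  where
  open FiniteField K isField using (N)
  open Integrality K isField
  open Translation (laurentRawRing K) (LaurentSeries.𝒪 K) proj₁ N 𝒪?
    integral-sound integral-complete nonintegral-sound nonintegral-complete
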